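{- Let $n\ge 6$ be an even integer, let $c$ be an integer with $1<c<n/2$, let $S=\{\pm 1,\pm c,n/2\}\subseteq\mathbb{Z}_n$, and assume that $\Gamma=\mathrm{Cay}(\mathbb{Z}_n;S)$ is closed distance magic. Assume that there exists $j\in\mathcal{J}_n(S)$ of type $2$. If $c$ is even, then $\Gamma$ is isomorphic to a graph $\mathrm{Cay}(\mathbb{Z}_n;\{\pm1,\pm c',n/2\})$ with $1<c'<n/2$ such that $n\equiv 2\pmod 4$, $c'$ is even, and $2(c'^2-1)$ is an odd multiple of $n$.
   Context: $\mathrm{Cay}(\mathbb{Z}_n;S)$ is the graph with vertex set $\mathbb{Z}_n$ in which $g,h$ are adjacent iff $h-g\in S$. A graph $\Gamma=(V,E)$ of order $n$ is closed distance magic if there are a bijection $\ell:V\to\{1,\ldots,n\}$ and a positive integer $r$ such that for all $u\in V$ the sum of the labels of $u$ and all its neighbors equals $r$. For $0\le j\le n-1$ let $\chi_j(x)=\cos(2\pi xj/n)+\mathbf{i}\sin(2\pi xj/n)$ and $\chi_j(S)=\sum_{x\in S}\chi_j(x)$; $\mathcal{J}_n(S)$ is the set of $j\in\{0,\ldots,n-1\}$ with $\chi_j(S)=-1$. An even $j\in\mathcal{J}_n(S)$ is of type $2$ if $\{\frac{2\pi j}{n},\frac{2\pi jc}{n}\}=\{\pm\frac{2\pi}{3}+2k_1\pi,\pm\frac{2\pi}{3}+2k_2\pi\}$ for some $k_1,k_2\in\mathbb{Z}$ and some (independent) choice of signs. -}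

module Defs where

open import Data.Nat as ℕ using (ℕ; zero; suc; NonZero; _!)
open import Data.Nat.Divisibility using (_∣_)
open import Data.Nat.ListAction using (sum)
open import Data.Nat.Properties using (_!≢0)
open import Data.Integer as ℤ using (ℤ; +_; _◃_; _%ℕ_)
open import Data.Integer.DivMod using (n%ℕd<d)
open import Data.Rational as ℚ using (ℚ; 0ℚ; 1ℚ; ∣_∣)
open import Algebra.Definitions.RawSemiring ℚ.+-*-rawSemiring using (_^_)
open import Data.Sign using (Sign)
open import Data.Fin using (Fin; toℕ; fromℕ<; _≟_)
open import Data.Fin.Subset using (Subset; _∈_; ⁅_⁆; _∪_)
open import Data.Fin.Subset.Properties using (_∈?_)
open import Data.List using (List; []; _∷_; map; filter; foldr; allFin)
open import Data.List.Relation.Unary.All using (All)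
open import Data.List.Relation.Unary.Any using (Any)
open import Data.Product using (Σ; ∃; _×_; _,_)
open import Function.Bundles using (_⤖_; _⇔_; Bijection)
open import Relation.Binary.PropositionalEquality using (_≡_)
open import Relation.Nullary using (Dec)
open import Relation.Nullary.Decidable using (_⊎-dec_)

-- Real numbers, presented by sequences of rational approximations.  The Cauchy
-- condition is not carried along: every sequence built below (from rationals,
-- π, +, *, cos, sin) converges, and x ≈ y says that the limits agree.

ℝ : Set
ℝ = ℕ → ℚ

infix  4 _≈_
infixl 6 _+ʳ_
infixl 7 _*ʳ_

_≈_ : ℝ → ℝ → Set
x ≈ y = ∀ (ε : ℚ) → 0ℚ ℚ.< ε →
        ∃ λ N → ∀ m → N ℕ.≤ m → ∣ x m ℚ.- y m ∣ ℚ.< ε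

fromℚ : ℚ → ℝ
fromℚ q _ = q

_+ʳ_ _*ʳ_ : ℝ → ℝ → ℝ
(x +ʳ y) m = x m ℚ.+ y m
(x *ʳ y) m = x m ℚ.* y m

sumBelow : ℕ → (ℕ → ℚ) → ℚ
sumBelow zero    f = 0ℚ
sumBelow (suc m) f = sumBelow m f ℚ.+ f m

-- The Leibniz series 4 (1 - 1/3 + 1/5 - 1/7 + ⋯) with consecutive terms
-- combined: π = Σₖ 8 / ((4k+1)(4k+3)).
π : ℝ
π m = sumBelow m λ k → + 8 ℚ./ (suc (4 ℕ.* k) ℕ.* suc (2 ℕ.+ 4 ℕ.* k))

-- Taylor polynomials of growing length, evaluated at the approximations of x.
-- Since the Taylor series converge locally uniformly, these diagonal sequences
-- converge to cos (lim x) and sin (lim x) whenever x converges.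
cos sin : ℝ → ℝ
cos x m = sumBelow m λ k →
  ((ℚ.- 1ℚ) ^ k) ℚ.* (x m ^ (2 ℕ.* k)) ℚ.* (ℚ._/_ (+ 1) ((2 ℕ.* k) !) {{(2 ℕ.* k) !≢0}})
sin x m = sumBelow m λ k →
  ((ℚ.- 1ℚ) ^ k) ℚ.* (x m ^ suc (2 ℕ.* k)) ℚ.* (ℚ._/_ (+ 1) (suc (2 ℕ.* k) !) {{suc (2 ℕ.* k) !≢0}})

record ℂ : Set where
  constructor _+𝐢_
  field
    re im : ℝ
open ℂ public

infix  4 _≈ᶜ_
infixl 6 _+ᶜ_

_≈ᶜ_ : ℂ → ℂ → Set
z ≈ᶜ w = (re z ≈ re w) × (im z ≈ im w)

_+ᶜ_ : ℂ → ℂ → ℂ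
z +ᶜ w = (re z +ʳ re w) +𝐢 (im z +ʳ im w)

0ᶜ -1ᶜ : ℂ
0ᶜ  = fromℚ 0ℚ +𝐢 fromℚ 0ℚ
-1ᶜ = fromℚ (ℚ.- 1ℚ) +𝐢 fromℚ 0ℚ

-- Adj is only required to be a decidable relation; for the Cayley graphs below
-- it is symmetric and irreflexive because the connection sets satisfy
-- S = -S and 0 ∉ S.
record Graph (n : ℕ) : Set₁ where
  field
    Adj  : Fin n → Fin n → Set
    adj? : ∀ u v → Dec (Adj u v)
open Graph public

infix 4 _≅_

_≅_ : ∀ {n} → Graph n → Graph n → Set
_≅_ {n} Γ Δ = Σ (Fin n ⤖ Fin n) λ f →
  ∀ u v → Adj Γ u v ⇔ Adj Δ (Bijection.to f u) (Bijection.to f v)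

closedNeighbourhood : ∀ {n} → Graph n → Fin n → List (Fin n)
closedNeighbourhood {n} Γ u = filter (λ v → (v ≟ u) ⊎-dec adj? Γ u v) (allFin n)

-- The label of v is 1 + toℕ (ℓ v), so that labels range over {1, …, n}.
ClosedDistanceMagic : ∀ {n} → Graph n → Set
ClosedDistanceMagic {n} Γ =
  Σ (Fin n ⤖ Fin n) λ ℓ →
  ∃ λ r → 0 ℕ.< r ×
    (∀ u → sum (map (λ v → suc (toℕ (Bijection.to ℓ v))) (closedNeighbourhood Γ u)) ≡ r)

-- ℤₙ is Fin n, and [ z ] is the residue class of z.
[_] : ∀ {n} .{{_ : NonZero n}} → ℤ → Fin n
[_] {n} z = fromℕ< (n%ℕd<d z n)

Cay : ∀ n .{{_ : NonZero n}} → Subset n → Graph n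
Cay n S = record
  { Adj  = λ g h → [ + toℕ h ℤ.- + toℕ g ] ∈ S
  ; adj? = λ g h → [ + toℕ h ℤ.- + toℕ g ] ∈? S
  }

-- {±1, ±c, n/2}, for even n.
connectionSet : ∀ n .{{_ : NonZero n}} → ℕ → Subset n
connectionSet n c =
  ⁅ [ + 1 ] ⁆ ∪ ⁅ [ ℤ.- + 1 ] ⁆ ∪ ⁅ [ + c ] ⁆ ∪ ⁅ [ ℤ.- + c ] ⁆ ∪ ⁅ [ + (n ℕ./ 2) ] ⁆

χ : ∀ {n} .{{_ : NonZero n}} → Fin n → Fin n → ℂ
χ {n} j x = cos θ +𝐢 sin θ
  where
  θ : ℝ
  θ = fromℚ (+ (2 ℕ.* toℕ x ℕ.* toℕ j) ℚ./ n) *ʳ π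

χΣ : ∀ {n} .{{_ : NonZero n}} → Fin n → Subset n → ℂ
χΣ {n} j S = foldr (λ x z → χ j x +ᶜ z) 0ᶜ (filter (_∈? S) (allFin n))

infix 4 _∈𝒥_

_∈𝒥_ : ∀ {n} .{{_ : NonZero n}} → Fin n → Subset n → Set
j ∈𝒥 S = χΣ j S ≈ᶜ -1ᶜ

-- Equality of finite sets of reals given by lists of their elements.
_≐_ : List ℝ → List ℝ → Set
xs ≐ ys = All (λ x → Any (x ≈_) ys) xs × All (λ y → Any (y ≈_) xs) ys

-- ±2π/3 + 2kπ, with sign σ.
±2π/3+2πk : Sign → ℤ → ℝ
±2π/3+2πk σ k = fromℚ ((σ ◃ 2) ℚ./ 3) *ʳ π +ʳ fromℚ ((+ 2 ℤ.* k) ℚ./ 1) *ʳ π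

IsType2 : ∀ n .{{_ : NonZero n}} → ℕ → Fin n → Set
IsType2 n c j =
  2 ∣ toℕ j × j ∈𝒥 connectionSet n c ×
  (Σ Sign λ σ₁ → Σ Sign λ σ₂ → Σ ℤ λ k₁ → Σ ℤ λ k₂ →
    (fromℚ (+ (2 ℕ.* toℕ j) ℚ./ n) *ʳ π ∷ fromℚ (+ (2 ℕ.* toℕ j ℕ.* c) ℚ./ n) *ʳ π ∷ [])
    ≐ (±2π/3+2πk σ₁ k₁ ∷ ±2π/3+2πk σ₂ k₂ ∷ []))

{-# OPTIONS --safe #-}
module Submission where

-- Write n = 2m and let x be the shift on functions ℤₙ → ℤ. Six times the labelling, minus
-- the magic constant, is an injective solution v of P v = 0, where
--   P = 1 + x^m + x^{-c} (x^{c-1} + 1)(x^{c+1} + 1).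
-- On v⁻ = (1 - x^m) v only the product survives. If m is even, then, c ± 1 being odd, both
-- factors are injective there, so v⁻ = 0, contradicting injectivity. If m is odd, consider
-- v⁺ = (1 + x^m) v and v⁻ together: modulo 2 both are annihilated by the product, hence by
-- x^D - 1 with D = 2(c² - 1). As the cyclic group generated by x^D has odd order on ℤₙ, an
-- infinite 2-adic descent lifts this to x^D v^± = v^±. Then v is D-periodic, and injectivity
-- gives n ∣ D, that is m ∣ c² - 1. So c′ = c works.

open import Defs
open import Data.Nat using (ℕ; zero; suc; z≤n; s≤s; _+_; _*_; _∸_; _^_; _≤_; _<_; _/_; _%_; NonZero)
open import Data.Nat.Divisibility using (_∣_; *-cancelʳ-∣; ∣⇒≤; divides)
open import Data.Nat.DivMod using (m<n⇒m%n≡m; m*n/n≡m; [m+kn]%n≡m%n)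
open import Data.Nat.ListAction.Properties using (sum-↭)
import Data.Nat.Properties as ℕₚ
import Data.Nat.Tactic.RingSolver as ℕSolver
open import Data.Fin using (Fin; toℕ; _≟_)
open import Data.Fin.Properties using (toℕ-fromℕ<; toℕ-injective; toℕ<n)
open import Data.Fin.Subset using (_∈_)
open import Data.Fin.Subset.Properties using (x∈⁅x⁆; x∈⁅y⁆⇒x≡y; x∈p∪q⁻; x∈p∪q⁺)
open import Data.Integer as ℤ using (ℤ; +_; 0ℤ; 1ℤ)
open import Data.Integer.DivMod using (n%ℕd<d; a≡a%ℕn+[a/ℕn]*n)
open import Data.Integer.Divisibility.Signed as ℤ∣ using () renaming (_∣_ to _∣ℤ_)
import Data.Integer.Properties as ℤₚ
open import Algebra.Properties.AbelianGroup ℤₚ.+-0-abelianGroup using () renaming (∙-cancelʳ to +-cancelʳ)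
import Data.Integer.Tactic.RingSolver as ℤSolver
open import Data.List using (List; []; _∷_; map; allFin)
open import Data.List.Membership.Propositional using () renaming (_∈_ to _∈ₗ_)
open import Data.List.Membership.Propositional.Properties using (∈-filter⁺; ∈-filter⁻; ∈-allFin)
open import Data.List.Membership.Propositional.Properties.WithK using (unique∧set⇒bag)
open import Data.List.Relation.Binary.BagAndSetEquality using (∼bag⇒↭)
open import Data.List.Relation.Binary.Permutation.Propositional using (_↭_)
import Data.List.Relation.Binary.Permutation.Propositional.Properties as ↭
import Data.List.Relation.Unary.AllPairs as AllPairs
import Data.List.Relation.Unary.AllPairs.Properties as AllPairsₚ
open import Data.List.Relation.Unary.Any using (here; there)
open import Data.List.Relation.Unary.Linked using ([-]; _∷_)
open import Data.List.Relation.Unary.Linked.Properties using (Linked⇒AllPairs)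
open import Data.List.Relation.Unary.Unique.Propositional using (Unique)
import Data.List.Relation.Unary.Unique.Propositional.Properties as Unique
open import Data.Sum using (_⊎_; inj₁; inj₂)
open import Data.Empty using (⊥-elim)
open import Data.Product using (Σ; _×_; _,_; proj₁; proj₂)
open import Function.Bundles using (Bijection; mk⇔)
open import Function.Construct.Identity using (⤖-id; ⇔-id)
open import Relation.Nullary using (¬_)
open import Relation.Nullary.Decidable using (_⊎-dec_)
open import Relation.Binary.PropositionalEquality using (_≡_; _≢_; refl; sym; trans; cong; cong₂; subst; module ≡-Reasoning)

-- Shift operators modulo 2

2∣2* : ∀ x → + 2 ∣ℤ + 2 ℤ.* x
2∣2* x = ℤ∣.∣m⇒∣m*n x ℤ∣.∣-refl

2∣-cong : ∀ {x} y k → + 2 ∣ℤ x → x ≡ y ℤ.+ + 2 ℤ.* k → + 2 ∣ℤ y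
2∣-cong y k h eq = ℤ∣.∣m+n∣n⇒∣m {m = y} (subst (+ 2 ∣ℤ_) eq h) (2∣2* k)

-- (x^p + 1)(x^q + 1) annihilates w modulo 2, where x is the shift operator.
Square : (ℕ → ℤ) → ℕ → ℕ → Set
Square w p q = ∀ i → + 2 ∣ℤ w i ℤ.+ w (i + p) ℤ.+ w (i + q) ℤ.+ w (i + (p + q))

square-sym : ∀ {w p q} → Square w p q → Square w q p
square-sym {w} {p} {q} h i =
  subst (+ 2 ∣ℤ_) (trans (swap (w i) (w (i + p)) (w (i + q)) (w (i + (p + q))))
                    (cong (λ e → w i ℤ.+ w (i + q) ℤ.+ w (i + p) ℤ.+ w (i + e)) (ℕₚ.+-comm p q))) (h i)
  where
  swap : ∀ a b c d → a ℤ.+ b ℤ.+ c ℤ.+ d ≡ a ℤ.+ c ℤ.+ b ℤ.+ d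
  swap = ℤSolver.solve-∀

square-* : ∀ {w p q} → Square w p q → ∀ k → Square w p (k * q)
square-* {w} {p} {q} h zero i rewrite ℕₚ.+-identityʳ i | ℕₚ.+-identityʳ p =
  subst (+ 2 ∣ℤ_) (double (w i) (w (i + p))) (2∣2* (w i ℤ.+ w (i + p)))
  where
  double : ∀ a b → + 2 ℤ.* (a ℤ.+ b) ≡ a ℤ.+ b ℤ.+ a ℤ.+ b
  double = ℤSolver.solve-∀
square-* {w} {p} {q} h (suc k) i =
  2∣-cong _ (w (i + q) ℤ.+ w (i + (p + q))) (ℤ∣.∣m∣n⇒∣m+n (h i) shifted)
    (chain (w i) (w (i + p)) (w (i + q)) (w (i + (p + q))) (w (i + (q + k * q))) (w (i + (p + (q + k * q)))))
  where
  chain : ∀ a b c d e f →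
    (a ℤ.+ b ℤ.+ c ℤ.+ d) ℤ.+ (c ℤ.+ d ℤ.+ e ℤ.+ f) ≡ (a ℤ.+ b ℤ.+ e ℤ.+ f) ℤ.+ + 2 ℤ.* (c ℤ.+ d)
  chain = ℤSolver.solve-∀
  shift₁ : ∀ i p q → i + q + p ≡ i + (p + q)
  shift₁ = ℕSolver.solve-∀
  shift₂ : ∀ i p q r → i + q + (p + r) ≡ i + (p + (q + r))
  shift₂ = ℕSolver.solve-∀
  shifted : + 2 ∣ℤ w (i + q) ℤ.+ w (i + (p + q)) ℤ.+ w (i + (q + k * q)) ℤ.+ w (i + (p + (q + k * q)))
  shifted with square-* {w} {p} {q} h k (i + q)
  ... | ih rewrite shift₁ i p q | ℕₚ.+-assoc i q (k * q) | shift₂ i p q (k * q) = ih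

-- With y = x^{pq}, this is (y + 1)² = y² + 1 modulo 2.
square⇒period : ∀ {w p q} → Square w p q → ∀ i → + 2 ∣ℤ w i ℤ.+ w (i + (q * p + p * q))
square⇒period {w} {p} {q} h i = 2∣-cong _ (w (i + q * p)) both (collect (w i) (w (i + q * p)) _)
  where
  collect : ∀ a b c → a ℤ.+ b ℤ.+ b ℤ.+ c ≡ a ℤ.+ c ℤ.+ + 2 ℤ.* b
  collect = ℤSolver.solve-∀
  both : + 2 ∣ℤ w i ℤ.+ w (i + q * p) ℤ.+ w (i + q * p) ℤ.+ w (i + (q * p + p * q))
  both = subst (λ e → + 2 ∣ℤ w i ℤ.+ w (i + q * p) ℤ.+ w (i + e) ℤ.+ w (i + (q * p + p * q)))
    (ℕₚ.*-comm p q)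
    (square-* {w} {q * p} {q} (square-sym {w} (square-* {w} {q} {p} (square-sym {w} h) q)) p i)

-- Descent for linear recurrences

orbitSum : (ℕ → ℤ) → ℕ → ℕ → ℕ → ℤ
orbitSum z d i zero    = 0ℤ
orbitSum z d i (suc k) = z i ℤ.+ orbitSum z d (i + d) k

orbitSum-telescopes : ∀ (w : ℕ → ℤ) d i k → orbitSum (λ j → w (j + d) ℤ.- w j) d i k ≡ w (i + k * d) ℤ.- w i
orbitSum-telescopes w d i zero rewrite ℕₚ.+-identityʳ i = sym (ℤₚ.+-inverseʳ (w i))
orbitSum-telescopes w d i (suc k)
  rewrite orbitSum-telescopes w d (i + d) k | ℕₚ.+-assoc i d (k * d) = tel (w i) (w (i + d)) (w (i + (d + k * d)))
  where
  tel : ∀ a b c → b ℤ.- a ℤ.+ (c ℤ.- b) ≡ c ℤ.- a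
  tel = ℤSolver.solve-∀

orbitSum-double : ∀ {z z′} → (∀ i → z i ≡ z′ i ℤ.* + 2) →
  ∀ d i k → orbitSum z d i k ≡ orbitSum z′ d i k ℤ.* + 2
orbitSum-double h d i zero = refl
orbitSum-double {z} {z′} h d i (suc k)
  rewrite h i | orbitSum-double {z} {z′} h d (i + d) k = sym (ℤₚ.*-distribʳ-+ (+ 2) (z′ i) _)

orbitSum-odd : ∀ {z d} → (∀ i → + 2 ∣ℤ z i ℤ.+ z (i + d)) →
  ∀ i k → + 2 ∣ℤ orbitSum z d i (suc (k * 2)) ℤ.+ z i
orbitSum-odd {z} h i zero = subst (+ 2 ∣ℤ_) (eq (z i)) (2∣2* (z i))
  where
  eq : ∀ a → + 2 ℤ.* a ≡ a ℤ.+ 0ℤ ℤ.+ a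
  eq = ℤSolver.solve-∀
orbitSum-odd {z} {d} h i (suc k) =
  2∣-cong _ (z (i + d + d))
    (ℤ∣.∣m∣n⇒∣m+n (2∣2* (z i)) (ℤ∣.∣m∣n⇒∣m+n (h (i + d)) (orbitSum-odd {z} {d} h (i + d + d) k)))
    (eq (z i) (z (i + d)) (z (i + d + d)) (orbitSum z d (i + d + d) (suc (k * 2))))
  where
  eq : ∀ a b c s → + 2 ℤ.* a ℤ.+ ((b ℤ.+ c) ℤ.+ (s ℤ.+ c)) ≡ a ℤ.+ (b ℤ.+ s) ℤ.+ a ℤ.+ + 2 ℤ.* c
  eq = ℤSolver.solve-∀

-- (x^b + 1)(x^{b+2} + 1) + 2 t x^{b+1} annihilates w.
Recur : ℕ → ℤ → (ℕ → ℤ) → Set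
Recur b t w = ∀ i →
  w i ℤ.+ w (i + b) ℤ.+ w (i + (2 + b)) ℤ.+ w (i + (b + (2 + b))) ℤ.+ + 2 ℤ.* (t ℤ.* w (i + suc b)) ≡ 0ℤ

recur⇒square : ∀ {b t w} → Recur b t w → Square w b (2 + b)
recur⇒square {b} {t} {w} h i =
  2∣-cong _ (t ℤ.* w (i + suc b)) (ℤ∣.divides 0ℤ refl) (sym (h i))

+-right-comm : ∀ i e d → i + e + d ≡ i + d + e
+-right-comm = ℕSolver.solve-∀

recur-difference : ∀ {b t w} d → Recur b t w → Recur b t (λ i → w (i + d) ℤ.- w i)
recur-difference {b} {t} {w} d h i
  rewrite +-right-comm i b d | +-right-comm i (2 + b) d | +-right-comm i (b + (2 + b)) d | +-right-comm i (suc b) d =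
  trans (eq t (w (i + d)) (w i) (w (i + d + b)) (w (i + b)) (w (i + d + (2 + b))) (w (i + (2 + b)))
         (w (i + d + (b + (2 + b)))) (w (i + (b + (2 + b)))) (w (i + d + suc b)) (w (i + suc b)))
    (cong₂ ℤ._-_ (h (i + d)) (h i))
  where
  eq : ∀ t a a′ b b′ c c′ d d′ e e′ →
    a ℤ.- a′ ℤ.+ (b ℤ.- b′) ℤ.+ (c ℤ.- c′) ℤ.+ (d ℤ.- d′) ℤ.+ + 2 ℤ.* (t ℤ.* (e ℤ.- e′)) ≡
    (a ℤ.+ b ℤ.+ c ℤ.+ d ℤ.+ + 2 ℤ.* (t ℤ.* e)) ℤ.- (a′ ℤ.+ b′ ℤ.+ c′ ℤ.+ d′ ℤ.+ + 2 ℤ.* (t ℤ.* e′))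
  eq = ℤSolver.solve-∀

recur-half : ∀ {b t z z′} → (∀ i → z i ≡ z′ i ℤ.* + 2) → Recur b t z → Recur b t z′
recur-half {b} {t} {z} {z′} h rec i = ℤₚ.*-cancelʳ-≡ _ 0ℤ (+ 2) (trans (eq t (z′ i) (z′ (i + b)) (z′ (i + (2 + b))) (z′ (i + (b + (2 + b)))) (z′ (i + suc b))) rec′)
  where
  eq : ∀ t a b c d e →
    (a ℤ.+ b ℤ.+ c ℤ.+ d ℤ.+ + 2 ℤ.* (t ℤ.* e)) ℤ.* + 2 ≡
    a ℤ.* + 2 ℤ.+ b ℤ.* + 2 ℤ.+ c ℤ.* + 2 ℤ.+ d ℤ.* + 2 ℤ.+ + 2 ℤ.* (t ℤ.* (e ℤ.* + 2))
  eq = ℤSolver.solve-∀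
  rec′ = subst (_≡ 0ℤ) (cong₂ ℤ._+_ (cong₂ ℤ._+_ (cong₂ ℤ._+_ (cong₂ ℤ._+_ (h i) (h _)) (h _)) (h _))
           (cong (λ e → + 2 ℤ.* (t ℤ.* e)) (h _))) (rec i)

-- Infinite descent: all values are even, and halving preserves the hypotheses.
recur-descent : ∀ {b t} k (let D = (2 + b) * b + b * (2 + b)) f {z} → Recur b t z →
  (∀ i → orbitSum z D i (suc (k * 2)) ≡ 0ℤ) → ∀ i → ℤ.∣ z i ∣ ≤ f → z i ≡ 0ℤ
recur-descent k zero rec orb i z≤0 = ℤₚ.∣i∣≡0⇒i≡0 (ℕₚ.n≤0⇒n≡0 z≤0)
recur-descent {b} {t} k (suc f) {z} rec orb i z≤f =
  trans (z≡ i) (cong (ℤ._* + 2) (recur-descent {b} {t} k f {z′} (recur-half {b} {t} {z} {z′} z≡ rec) orb′ i z′≤f))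
  where
  D = (2 + b) * b + b * (2 + b)
  even : ∀ j → + 2 ∣ℤ z j
  even j = subst (+ 2 ∣ℤ_) (trans (cong (ℤ._+ z j) (orb j)) (ℤₚ.+-identityˡ (z j)))
    (orbitSum-odd {z} {D} (square⇒period {z} {b} {2 + b} (recur⇒square {b} {t} {z} rec)) j k)
  z′ : ℕ → ℤ
  z′ j = ℤ∣._∣_.quotient (even j)
  z≡ : ∀ j → z j ≡ z′ j ℤ.* + 2
  z≡ j = ℤ∣._∣_.equality (even j)
  orb′ : ∀ j → orbitSum z′ D j (suc (k * 2)) ≡ 0ℤ
  orb′ j = ℤₚ.*-cancelʳ-≡ _ 0ℤ (+ 2) (trans (sym (orbitSum-double {z} {z′} z≡ D j (suc (k * 2)))) (orb j))
  half-≤ : ∀ a → a * 2 ≤ suc f → a ≤ f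
  half-≤ zero    _       = z≤n
  half-≤ (suc a) (s≤s p) = ℕₚ.≤-trans (s≤s (ℕₚ.m≤m*n a 2)) p
  z′≤f : ℤ.∣ z′ i ∣ ≤ f
  z′≤f = half-≤ _ (subst (_≤ suc f) (trans (cong ℤ.∣_∣ (z≡ i)) (ℤₚ.abs-* (z′ i) (+ 2))) z≤f)

Periodic : ℕ → (ℕ → ℤ) → Set
Periodic d w = ∀ i → w (i + d) ≡ w i

periodic-* : ∀ {d w} → Periodic d w → ∀ k → Periodic (k * d) w
periodic-* {d} {w} h zero    i = cong w (ℕₚ.+-identityʳ i)
periodic-* {d} {w} h (suc k) i =
  trans (cong w (sym (ℕₚ.+-assoc i d (k * d)))) (trans (periodic-* h k (i + d)) (h i))

recur⇒periodic : ∀ {b t w} k → Recur b t w → Periodic (suc (k * 2) * 2) w →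
  Periodic ((2 + b) * b + b * (2 + b)) w
recur⇒periodic {b} {t} {w} k rec per i =
  ℤₚ.i-j≡0⇒i≡j _ _ (recur-descent {b} {t} k _ {λ j → w (j + D) ℤ.- w j} (recur-difference {b} {t} {w} D rec) orb i ℕₚ.≤-refl)
  where
  D = (2 + b) * b + b * (2 + b)
  eq : ∀ m b → m * ((2 + b) * b + b * (2 + b)) ≡ b * (2 + b) * (m * 2)
  eq = ℕSolver.solve-∀
  orb : ∀ j → orbitSum (λ l → w (l + D) ℤ.- w l) D j (suc (k * 2)) ≡ 0ℤ
  orb j = trans (orbitSum-telescopes w D j (suc (k * 2)))
    (ℤₚ.i≡j⇒i-j≡0 (trans (cong (λ e → w (j + e)) (eq (suc (k * 2)) b))
                             (periodic-* {suc (k * 2) * 2} {w} per (b * (2 + b)) j)))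

Antiperiodic : ℕ → (ℕ → ℤ) → Set
Antiperiodic d w = ∀ i → w (i + d) ≡ ℤ.- w i

antiperiodic-even : ∀ {d w} → Antiperiodic d w → ∀ k → Periodic (k * 2 * d) w
antiperiodic-even {d} {w} h k = subst (λ e → Periodic e w) (sym (ℕₚ.*-assoc k 2 d))
  (periodic-* twice k)
  where
  twice : Periodic (2 * d) w
  twice i = trans (cong w (assoc i d)) (trans (h (i + d)) (trans (cong ℤ.-_ (h i)) (ℤₚ.neg-involutive (w i))))
    where
    assoc : ∀ i d → i + 2 * d ≡ i + d + d
    assoc = ℕSolver.solve-∀

antiperiodic-odd : ∀ {d w} → Antiperiodic d w → ∀ k → Antiperiodic (suc (k * 2) * d) w
antiperiodic-odd {d} {w} h k i =
  trans (cong w (sym (ℕₚ.+-assoc i d (k * 2 * d)))) (trans (antiperiodic-even h k (i + d)) (h i))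

i≡-i⇒i≡0 : ∀ {i} → i ≡ ℤ.- i → i ≡ 0ℤ
i≡-i⇒i≡0 {+ zero} _ = refl

antiperiodic-clash : ∀ {w} k l → Antiperiodic (suc (k * 2)) w → Antiperiodic (l * 2) w → ∀ i → w i ≡ 0ℤ
antiperiodic-clash {w} k l odd even i = i≡-i⇒i≡0
  (trans (sym (antiperiodic-even odd l i))
    (trans (cong (λ e → w (i + e)) (ℕₚ.*-comm (l * 2) (suc (k * 2)))) (antiperiodic-odd even k i)))

-- Kernel of the closed adjacency operator

even∨odd : ∀ m → (Σ ℕ λ k → m ≡ k * 2) ⊎ (Σ ℕ λ k → m ≡ suc (k * 2))
even∨odd zero = inj₁ (0 , refl)
even∨odd (suc m) with even∨odd m
... | inj₁ (k , refl) = inj₂ (k , refl)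
... | inj₂ (k , refl) = inj₁ (suc k , refl)

-- With b = c - 1; the equation for the vertex i + c is indexed by i, so that no negative
-- shifts occur.
module Kernel (b m : ℕ) (v : ℕ → ℤ) (v-periodic : Periodic (m * 2) v)
  (v-kernel : ∀ i → v i ℤ.+ v (i + b) ℤ.+ v (i + (2 + b)) ℤ.+ v (i + (b + (2 + b)))
                      ℤ.+ v (i + suc b) ℤ.+ v (i + suc b + m) ≡ 0ℤ) where

  v⁺ v⁻ : ℕ → ℤ
  v⁺ i = v i ℤ.+ v (i + m)
  v⁻ i = v i ℤ.- v (i + m)

  v-twice : ∀ i → v (i + m + m) ≡ v i
  v-twice i = trans (cong v (eq i m)) (v-periodic i)
    where
    eq : ∀ i m → i + m + m ≡ i + m * 2
    eq = ℕSolver.solve-∀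

  v-kernel-shifted : ∀ i → v (i + m) ℤ.+ v (i + b + m) ℤ.+ v (i + (2 + b) + m) ℤ.+ v (i + (b + (2 + b)) + m)
                      ℤ.+ v (i + suc b + m) ℤ.+ v (i + suc b) ≡ 0ℤ
  v-kernel-shifted i
    rewrite +-right-comm i b m | +-right-comm i (2 + b) m | +-right-comm i (b + (2 + b)) m
    = trans (cong₂ (λ x y → v (i + m) ℤ.+ v (i + m + b) ℤ.+ v (i + m + (2 + b)) ℤ.+ v (i + m + (b + (2 + b))) ℤ.+ x ℤ.+ y)
         (cong v (+-right-comm i (suc b) m))
         (trans (sym (v-twice (i + suc b))) (cong (λ e → v (e + m)) (+-right-comm i (suc b) m))))
       (v-kernel (i + m))

  v⁺-recur : Recur b 1ℤ v⁺
  v⁺-recur i = trans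
    (eq (v i) (v (i + b)) (v (i + (2 + b))) (v (i + (b + (2 + b)))) (v (i + suc b))
        (v (i + m)) (v (i + b + m)) (v (i + (2 + b) + m)) (v (i + (b + (2 + b)) + m)) (v (i + suc b + m)))
    (cong₂ ℤ._+_ (v-kernel i) (v-kernel-shifted i))
    where
    eq : ∀ a b c d e a′ b′ c′ d′ e′ →
      (a ℤ.+ a′) ℤ.+ (b ℤ.+ b′) ℤ.+ (c ℤ.+ c′) ℤ.+ (d ℤ.+ d′) ℤ.+ + 2 ℤ.* (1ℤ ℤ.* (e ℤ.+ e′)) ≡
      (a ℤ.+ b ℤ.+ c ℤ.+ d ℤ.+ e ℤ.+ e′) ℤ.+ (a′ ℤ.+ b′ ℤ.+ c′ ℤ.+ d′ ℤ.+ e′ ℤ.+ e)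
    eq = ℤSolver.solve-∀

  v⁻-recur : Recur b 0ℤ v⁻
  v⁻-recur i = trans
    (eq (v i) (v (i + b)) (v (i + (2 + b))) (v (i + (b + (2 + b)))) (v (i + suc b))
        (v (i + m)) (v (i + b + m)) (v (i + (2 + b) + m)) (v (i + (b + (2 + b)) + m)) (v (i + suc b + m)))
    (cong₂ ℤ._-_ (v-kernel i) (v-kernel-shifted i))
    where
    eq : ∀ a b c d e a′ b′ c′ d′ e′ →
      (a ℤ.- a′) ℤ.+ (b ℤ.- b′) ℤ.+ (c ℤ.- c′) ℤ.+ (d ℤ.- d′) ℤ.+ + 2 ℤ.* (0ℤ ℤ.* (e ℤ.- e′)) ≡
      (a ℤ.+ b ℤ.+ c ℤ.+ d ℤ.+ e ℤ.+ e′) ℤ.- (a′ ℤ.+ b′ ℤ.+ c′ ℤ.+ d′ ℤ.+ e′ ℤ.+ e)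
    eq = ℤSolver.solve-∀

  v⁻-antiperiodic : Antiperiodic m v⁻
  v⁻-antiperiodic i rewrite v-twice i = eq (v i) (v (i + m))
    where
    eq : ∀ x y → y ℤ.- x ≡ ℤ.- (x ℤ.- y)
    eq = ℤSolver.solve-∀

  m-even⇒v⁻≡0 : ∀ k l → b ≡ suc (l * 2) → m ≡ k * 2 → ∀ i → v⁻ i ≡ 0ℤ
  m-even⇒v⁻≡0 k l refl refl = antiperiodic-clash l k v⁻-odd v⁻-antiperiodic
    where
    h : ℕ → ℤ
    h i = v⁻ i ℤ.+ v⁻ (i + b)
    h-even : Antiperiodic m h
    h-even i rewrite +-right-comm i m b =
      trans (cong₂ ℤ._+_ (v⁻-antiperiodic i) (v⁻-antiperiodic (i + b)))
            (sym (ℤₚ.neg-distrib-+ (v⁻ i) (v⁻ (i + b))))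
    h-odd : Antiperiodic (2 + b) h
    h-odd i = begin
      h (i + (2 + b))               ≡⟨ cong (λ e → v⁻ (i + (2 + b)) ℤ.+ v⁻ e) (shift i b) ⟩
      h₂                            ≡⟨ eq (h i) h₂ ⟩
      h i ℤ.+ h₂ ℤ.- h i            ≡⟨ cong (ℤ._- h i) (trans (eq′ (v⁻ i) _ _ _) (v⁻-recur i)) ⟩
      0ℤ ℤ.- h i                    ≡⟨ ℤₚ.+-identityˡ _ ⟩
      ℤ.- h i                       ∎
      where
      open ≡-Reasoning
      h₂ = v⁻ (i + (2 + b)) ℤ.+ v⁻ (i + (b + (2 + b)))
      shift : ∀ i b → i + (2 + b) + b ≡ i + (b + (2 + b))
      shift = ℕSolver.solve-∀
      eq : ∀ x y → y ≡ x ℤ.+ y ℤ.- x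
      eq = ℤSolver.solve-∀
      eq′ : ∀ a b c d → a ℤ.+ b ℤ.+ (c ℤ.+ d) ≡ a ℤ.+ b ℤ.+ c ℤ.+ d ℤ.+ 0ℤ
      eq′ = ℤSolver.solve-∀
    v⁻-odd : Antiperiodic b v⁻
    v⁻-odd i = trans (eq (v⁻ i) (v⁻ (i + b)))
      (trans (cong (ℤ._- v⁻ i) (antiperiodic-clash {h} (suc l) k h-odd h-even i)) (ℤₚ.+-identityˡ _))
      where
      eq : ∀ x y → y ≡ x ℤ.+ y ℤ.- x
      eq = ℤSolver.solve-∀

  m-odd⇒v-periodic : ∀ k → m ≡ suc (k * 2) → Periodic ((2 + b) * b + b * (2 + b)) v
  m-odd⇒v-periodic k refl i = ℤₚ.*-cancelˡ-≡ (+ 2) _ _ (begin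
    + 2 ℤ.* v (i + D)              ≡⟨ eq (v (i + D)) (v (i + D + m)) ⟨
    v⁺ (i + D) ℤ.+ v⁻ (i + D)      ≡⟨ cong₂ ℤ._+_ (recur⇒periodic {b} {1ℤ} {v⁺} k v⁺-recur v⁺-periodic i)
                                                  (recur⇒periodic {b} {0ℤ} {v⁻} k v⁻-recur v⁻-periodic i) ⟩
    v⁺ i ℤ.+ v⁻ i                  ≡⟨ eq (v i) (v (i + m)) ⟩
    + 2 ℤ.* v i                    ∎)
    where
    open ≡-Reasoning
    D = (2 + b) * b + b * (2 + b)
    eq : ∀ x y → (x ℤ.+ y) ℤ.+ (x ℤ.- y) ≡ + 2 ℤ.* x
    eq = ℤSolver.solve-∀
    shifted : ∀ i → v (i + m * 2 + m) ≡ v (i + m)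
    shifted i = trans (cong v (+-right-comm i (m * 2) m)) (v-periodic (i + m))
    v⁺-periodic : Periodic (m * 2) v⁺
    v⁺-periodic i = cong₂ ℤ._+_ (v-periodic i) (shifted i)
    v⁻-periodic : Periodic (m * 2) v⁻
    v⁻-periodic i = cong₂ ℤ._-_ (v-periodic i) (shifted i)

  kernel⇒∣ : ∀ l → b ≡ suc (l * 2) → .{{NonZero m}} → (∀ d → v d ≡ v 0 → m * 2 ∣ d) →
    (Σ ℕ λ k → m ≡ suc (k * 2)) × m ∣ b * (2 + b)
  kernel⇒∣ l b-odd inj with even∨odd m
  ... | inj₁ (k , m-even) =
    ⊥-elim (ℕₚ.<⇒≱ (ℕₚ.m<m*n m 2 (s≤s (s≤s z≤n)))
      (∣⇒≤ (inj m (sym (ℤₚ.i-j≡0⇒i≡j _ _ (m-even⇒v⁻≡0 k l b-odd m-even 0))))))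
  ... | inj₂ (k , m-odd) = (k , m-odd) ,
    *-cancelʳ-∣ 2 (subst (m * 2 ∣_) (eq b) (inj _ (m-odd⇒v-periodic k m-odd 0)))
    where
    eq : ∀ b → (2 + b) * b + b * (2 + b) ≡ b * (2 + b) * 2
    eq = ℕSolver.solve-∀

-- Residues and closed neighbourhoods

∣ℤ-cong : ∀ {n x y} → x ≡ y → n ∣ℤ x → n ∣ℤ y
∣ℤ-cong {n} = subst (n ∣ℤ_)

module _ {n : ℕ} .{{_ : NonZero n}} where

  toℕ-[] : ∀ x → + n ∣ℤ x ℤ.- + toℕ {n} [ x ]
  toℕ-[] x rewrite toℕ-fromℕ< (n%ℕd<d x n) = ℤ∣.divides (x ℤ./ℕ n)
    (trans (cong (ℤ._- + (x ℤ.%ℕ n)) (a≡a%ℕn+[a/ℕn]*n x n)) (eq (+ (x ℤ.%ℕ n)) _))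
    where
    eq : ∀ a b → a ℤ.+ b ℤ.- a ≡ b
    eq = ℤSolver.solve-∀

  []-injective : ∀ x y → [_] {n} x ≡ [ y ] → + n ∣ℤ x ℤ.- y
  []-injective x y h = ∣ℤ-cong (eq x y _)
    (ℤ∣.∣m∣n⇒∣m-n (toℕ-[] x) (subst (λ e → + n ∣ℤ y ℤ.- + toℕ e) (sym h) (toℕ-[] y)))
    where
    eq : ∀ x y r → (x ℤ.- r) ℤ.- (y ℤ.- r) ≡ x ℤ.- y
    eq = ℤSolver.solve-∀

  ∣∧<⇒≡ : ∀ {j k} → j < n → k < n → + n ∣ℤ + j ℤ.- + k → j ≡ k
  ∣∧<⇒≡ {j} {k} j<n k<n h with ℤ.∣ + j ℤ.- + k ∣ in eq | ℤ∣.∣⇒∣ᵤ h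
  ... | zero  | _ = ℤₚ.+-injective (ℤₚ.i-j≡0⇒i≡j _ _ (ℤₚ.∣i∣≡0⇒i≡0 eq))
  ... | suc d | n∣d = ⊥-elim (ℕₚ.<⇒≱ d<n (∣⇒≤ n∣d))
    where
    d<n : suc d < n
    d<n = ℕₚ.≤-<-trans
      (ℕₚ.≤-reflexive (trans (sym eq) (cong ℤ.∣_∣ (ℤₚ.m-n≡m⊖n j k))))
      (ℕₚ.≤-<-trans (ℤₚ.∣m⊝n∣≤m⊔n j k) (ℕₚ.⊔-lub j<n k<n))

  []-cong : ∀ x y → + n ∣ℤ x ℤ.- y → [_] {n} x ≡ [ y ]
  []-cong x y h = toℕ-injective (∣∧<⇒≡ (toℕ<n [ x ]) (toℕ<n [ y ])
    (∣ℤ-cong (eq x y _ _) (ℤ∣.∣m∣n⇒∣m-n (ℤ∣.∣m∣n⇒∣m+n h (toℕ-[] y)) (toℕ-[] x))))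
    where
    eq : ∀ x y r s → (x ℤ.- y) ℤ.+ (y ℤ.- s) ℤ.- (x ℤ.- r) ≡ r ℤ.- s
    eq = ℤSolver.solve-∀

  [toℕ] : ∀ (v : Fin n) → [ + toℕ v ] ≡ v
  [toℕ] v = toℕ-injective (trans (toℕ-fromℕ< _) (m<n⇒m%n≡m (toℕ<n v)))

  []-shift-injective : ∀ i j k → j < k → k < n → [_] {n} (+ (i + j)) ≢ [ + (i + k) ]
  []-shift-injective i j k j<k k<n h = ℕₚ.<⇒≢ j<k
    (∣∧<⇒≡ (ℕₚ.<-trans j<k k<n) k<n (∣ℤ-cong (eq (+ i) (+ j) (+ k)) ([]-injective (+ (i + j)) (+ (i + k)) h)))
    where
    eq : ∀ i j k → (i ℤ.+ j) ℤ.- (i ℤ.+ k) ≡ j ℤ.- k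
    eq = ℤSolver.solve-∀

  module _ (v : Fin n) (x d y : ℤ) (d+x≡y : d ℤ.+ x ≡ y) where

    difference⇒≡ : [ + toℕ v ℤ.- + toℕ {n} [ x ] ] ≡ [ d ] → v ≡ [ y ]
    difference⇒≡ h = trans (sym ([toℕ] v)) ([]-cong (+ toℕ v) y (∣ℤ-cong
      (trans (eq (+ toℕ v) (+ toℕ {n} [ x ]) d x) (cong (ℤ._-_ (+ toℕ v)) d+x≡y))
      (ℤ∣.∣m∣n⇒∣m-n ([]-injective (+ toℕ v ℤ.- + toℕ {n} [ x ]) d h) (toℕ-[] x))))
      where
      eq : ∀ v u d x → (v ℤ.- u) ℤ.- d ℤ.- (x ℤ.- u) ≡ v ℤ.- (d ℤ.+ x)
      eq = ℤSolver.solve-∀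

    ≡⇒difference : v ≡ [ y ] → [ + toℕ v ℤ.- + toℕ {n} [ x ] ] ≡ [ d ]
    ≡⇒difference h = []-cong (+ toℕ v ℤ.- + toℕ {n} [ x ]) d (∣ℤ-cong
      (trans (cong (λ e → (+ toℕ v ℤ.- e) ℤ.+ (x ℤ.- + toℕ {n} [ x ])) (sym d+x≡y))
             (eq (+ toℕ v) (+ toℕ {n} [ x ]) d x))
      (ℤ∣.∣m∣n⇒∣m+n ([]-injective (+ toℕ v) y (trans ([toℕ] v) h)) (toℕ-[] x)))
      where
      eq : ∀ v u d x → v ℤ.- (d ℤ.+ x) ℤ.+ (x ℤ.- u) ≡ (v ℤ.- u) ℤ.- d
      eq = ℤSolver.solve-∀

  generators : ℕ → List (Fin n)
  generators c = [ + 1 ] ∷ [ ℤ.- + 1 ] ∷ [ + c ] ∷ [ ℤ.- + c ] ∷ [ + (n / 2) ] ∷ []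

  ∈-connectionSet⁻ : ∀ {c x} → x ∈ connectionSet n c → x ∈ₗ generators c
  ∈-connectionSet⁻ h with x∈p∪q⁻ _ _ h
  ... | inj₁ p = here (x∈⁅y⁆⇒x≡y _ p)
  ... | inj₂ h with x∈p∪q⁻ _ _ h
  ... | inj₁ p = there (here (x∈⁅y⁆⇒x≡y _ p))
  ... | inj₂ h with x∈p∪q⁻ _ _ h
  ... | inj₁ p = there (there (here (x∈⁅y⁆⇒x≡y _ p)))
  ... | inj₂ h with x∈p∪q⁻ _ _ h
  ... | inj₁ p = there (there (there (here (x∈⁅y⁆⇒x≡y _ p))))
  ... | inj₂ p = there (there (there (there (here (x∈⁅y⁆⇒x≡y _ p)))))

  ∈-connectionSet⁺ : ∀ {c x} → x ∈ₗ generators c → x ∈ connectionSet n c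
  ∈-connectionSet⁺ (here refl)                                 = x∈p∪q⁺ (inj₁ (x∈⁅x⁆ _))
  ∈-connectionSet⁺ (there (here refl))                         = x∈p∪q⁺ (inj₂ (x∈p∪q⁺ (inj₁ (x∈⁅x⁆ _))))
  ∈-connectionSet⁺ (there (there (here refl)))                 =
    x∈p∪q⁺ (inj₂ (x∈p∪q⁺ (inj₂ (x∈p∪q⁺ (inj₁ (x∈⁅x⁆ _))))))
  ∈-connectionSet⁺ (there (there (there (here refl))))         =
    x∈p∪q⁺ (inj₂ (x∈p∪q⁺ (inj₂ (x∈p∪q⁺ (inj₂ (x∈p∪q⁺ (inj₁ (x∈⁅x⁆ _))))))))
  ∈-connectionSet⁺ (there (there (there (there (here refl))))) =
    x∈p∪q⁺ (inj₂ (x∈p∪q⁺ (inj₂ (x∈p∪q⁺ (inj₂ (x∈p∪q⁺ (inj₂ (x∈⁅x⁆ _))))))))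

module Neighbourhood (b m : ℕ) .{{_ : NonZero (m * 2)}} (1≤b : 1 ≤ b) (c<m : suc b < m) where

  private n = m * 2

  offsets : List ℕ
  offsets = 0 ∷ b ∷ suc b ∷ 2 + b ∷ b + (2 + b) ∷ suc b + m ∷ []

  vertices : ℕ → List (Fin n)
  vertices i = map (λ k → [ + (i + k) ]) offsets

  vertices-unique : ∀ i → Unique (vertices i)
  vertices-unique i = AllPairsₚ.map⁺
    (AllPairs.map (λ {j} {k} (j<k , k<n) → []-shift-injective i j k j<k k<n)
      (Linked⇒AllPairs {R = λ j k → j < k × k < n} <-bounded-trans
        ((1≤b , b<n) ∷ (ℕₚ.≤-refl , c<n) ∷ (ℕₚ.≤-refl , 2+b<n) ∷
         (ℕₚ.m<n+m (2 + b) 1≤b , 2c<n) ∷ (2c<c+m , c+m<n) ∷ [-])))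
    where
    <-bounded-trans : ∀ {i j k : ℕ} → i < j × j < n → j < k × k < n → i < k × k < n
    <-bounded-trans (i<j , _) (j<k , k<n) = ℕₚ.<-trans i<j j<k , k<n
    c+m<n : suc b + m < n
    c+m<n = subst (suc b + m <_) (eq m) (ℕₚ.+-monoˡ-< m c<m)
      where
      eq : ∀ m → m + m ≡ m * 2
      eq = ℕSolver.solve-∀
    2c<c+m : b + (2 + b) < suc b + m
    2c<c+m = subst (_< suc b + m) (eq b) (ℕₚ.+-monoʳ-< (suc b) c<m)
      where
      eq : ∀ b → suc b + suc b ≡ b + (2 + b)
      eq = ℕSolver.solve-∀
    2c<n  = ℕₚ.<-trans 2c<c+m c+m<n
    2+b<n = ℕₚ.<-trans (ℕₚ.m<n+m (2 + b) 1≤b) 2c<n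
    c<n   = ℕₚ.<-trans ℕₚ.≤-refl 2+b<n
    b<n   = ℕₚ.<-trans ℕₚ.≤-refl c<n

  module _ (i : ℕ) where

    private
      Γ = Cay n (connectionSet n (suc b))
      u = [_] {n} (+ (i + suc b))

      1-shift : ∀ i b → + 1 ℤ.+ (i ℤ.+ (+ 1 ℤ.+ b)) ≡ i ℤ.+ (+ 2 ℤ.+ b)
      1-shift = ℤSolver.solve-∀
      -1-shift : ∀ i b → ℤ.- + 1 ℤ.+ (i ℤ.+ (+ 1 ℤ.+ b)) ≡ i ℤ.+ b
      -1-shift = ℤSolver.solve-∀
      c-shift : ∀ i b → (+ 1 ℤ.+ b) ℤ.+ (i ℤ.+ (+ 1 ℤ.+ b)) ≡ i ℤ.+ (b ℤ.+ (+ 2 ℤ.+ b))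
      c-shift = ℤSolver.solve-∀
      -c-shift : ∀ i b → ℤ.- (+ 1 ℤ.+ b) ℤ.+ (i ℤ.+ (+ 1 ℤ.+ b)) ≡ i ℤ.+ + 0
      -c-shift = ℤSolver.solve-∀
      m-shift′ : ∀ i c m → m ℤ.+ (i ℤ.+ c) ≡ i ℤ.+ (c ℤ.+ m)
      m-shift′ = ℤSolver.solve-∀
      m-shift : + (n / 2) ℤ.+ + (i + suc b) ≡ + (i + (suc b + m))
      m-shift = trans (cong (λ e → + e ℤ.+ + (i + suc b)) (m*n/n≡m m 2)) (m-shift′ (+ i) (+ suc b) (+ m))

      vertex : ∀ {v} d k → d ℤ.+ + (i + suc b) ≡ + (i + k) →
        [ + toℕ v ℤ.- + toℕ u ] ≡ [ d ] → v ≡ [ + (i + k) ]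
      vertex {v} d k = difference⇒≡ v (+ (i + suc b)) d (+ (i + k))
      step : ∀ {v} d k → d ℤ.+ + (i + suc b) ≡ + (i + k) →
        v ≡ [ + (i + k) ] → [ + toℕ v ℤ.- + toℕ u ] ≡ [ d ]
      step {v} d k = ≡⇒difference v (+ (i + suc b)) d (+ (i + k))

    neighbour⇒vertex : ∀ {v} → v ≡ u ⊎ Adj Γ u v → v ∈ₗ vertices i
    neighbour⇒vertex (inj₁ refl) = there (there (here refl))
    neighbour⇒vertex (inj₂ adj) with ∈-connectionSet⁻ adj
    ... | here p                                  = there (there (there (here (vertex (+ 1) (2 + b) (1-shift (+ i) (+ b)) p))))
    ... | there (here p)                          = there (here (vertex (ℤ.- + 1) b (-1-shift (+ i) (+ b)) p))
    ... | there (there (here p))                  = there (there (there (there (here (vertex (+ suc b) (b + (2 + b)) (c-shift (+ i) (+ b)) p)))))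
    ... | there (there (there (here p)))          = here (vertex (ℤ.- + suc b) 0 (-c-shift (+ i) (+ b)) p)
    ... | there (there (there (there (here p))))  =
      there (there (there (there (there (here (vertex (+ (n / 2)) (suc b + m) m-shift p))))))

    vertex⇒neighbour : ∀ {v} → v ∈ₗ vertices i → v ≡ u ⊎ Adj Γ u v
    vertex⇒neighbour (here p) = inj₂ (∈-connectionSet⁺
      (there (there (there (here (step (ℤ.- + suc b) 0 (-c-shift (+ i) (+ b)) p))))))
    vertex⇒neighbour (there (here p)) = inj₂ (∈-connectionSet⁺
      (there (here (step (ℤ.- + 1) b (-1-shift (+ i) (+ b)) p))))
    vertex⇒neighbour (there (there (here p))) = inj₁ p
    vertex⇒neighbour (there (there (there (here p)))) = inj₂ (∈-connectionSet⁺
      (here (step (+ 1) (2 + b) (1-shift (+ i) (+ b)) p)))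
    vertex⇒neighbour (there (there (there (there (here p))))) = inj₂ (∈-connectionSet⁺
      (there (there (here (step (+ suc b) (b + (2 + b)) (c-shift (+ i) (+ b)) p)))))
    vertex⇒neighbour (there (there (there (there (there (here p)))))) = inj₂ (∈-connectionSet⁺
      (there (there (there (there (here (step (+ (n / 2)) (suc b + m) m-shift p)))))))

    closedNeighbourhood-↭ : closedNeighbourhood Γ u ↭ vertices i
    closedNeighbourhood-↭ = ∼bag⇒↭ (unique∧set⇒bag
      (Unique.filter⁺ P? (Unique.allFin⁺ n)) (vertices-unique i)
      (mk⇔ (λ v∈ → neighbour⇒vertex (proj₂ (∈-filter⁻ P? {xs = allFin n} v∈)))
           (λ v∈ → ∈-filter⁺ P? (∈-allFin _) (vertex⇒neighbour v∈))))
      where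
      P? = λ v → (v ≟ u) ⊎-dec adj? Γ u v

closedDistanceMagic⇒∣ : ∀ l m .{{_ : NonZero (m * 2)}} → let b = suc (l * 2) in suc b < m →
  ClosedDistanceMagic (Cay (m * 2) (connectionSet (m * 2) (suc b))) →
  (Σ ℕ λ k → m ≡ suc (k * 2)) × m ∣ b * (2 + b)
closedDistanceMagic⇒∣ l m@(suc _) c<m (ℓ , r , _ , magic) =
  Kernel.kernel⇒∣ b m v v-periodic v-kernel l refl v-injective
  where
  b = suc (l * 2)
  open Neighbourhood b m (s≤s z≤n) c<m
  label : ℕ → ℕ
  label i = suc (toℕ (Bijection.to ℓ [ + i ]))
  -- Subtracting the average label r / 6, cleared of its denominator.
  v : ℕ → ℤ
  v i = + 6 ℤ.* + label i ℤ.- + r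
  v-periodic : Periodic (m * 2) v
  v-periodic i = cong (λ e → + 6 ℤ.* + suc (toℕ (Bijection.to ℓ e)) ℤ.- + r)
    ([]-cong (+ (i + m * 2)) (+ i) (∣ℤ-cong (eq (+ i) (+ (m * 2))) ℤ∣.∣-refl))
    where
    eq : ∀ i n → n ≡ i ℤ.+ n ℤ.- i
    eq = ℤSolver.solve-∀
  v-kernel : ∀ i → v i ℤ.+ v (i + b) ℤ.+ v (i + (2 + b)) ℤ.+ v (i + (b + (2 + b)))
                      ℤ.+ v (i + suc b) ℤ.+ v (i + suc b + m) ≡ 0ℤ
  v-kernel i = begin
    v i ℤ.+ v (i + b) ℤ.+ v (i + (2 + b)) ℤ.+ v (i + (b + (2 + b))) ℤ.+ v (i + suc b) ℤ.+ v (i + suc b + m)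
      ≡⟨ cong₂ (λ x y → v x ℤ.+ v (i + b) ℤ.+ v (i + (2 + b)) ℤ.+ v (i + (b + (2 + b))) ℤ.+ v (i + suc b) ℤ.+ v y)
           (sym (ℕₚ.+-identityʳ i)) (ℕₚ.+-assoc i (suc b) m) ⟩
    v (i + 0) ℤ.+ v (i + b) ℤ.+ v (i + (2 + b)) ℤ.+ v (i + (b + (2 + b))) ℤ.+ v (i + suc b) ℤ.+ v (i + (suc b + m))
      ≡⟨ eq (+ label (i + 0)) (+ label (i + b)) (+ label (i + suc b)) (+ label (i + (2 + b)))
              (+ label (i + (b + (2 + b)))) (+ label (i + (suc b + m))) (+ r) ⟩
    + 6 ℤ.* (+ (label (i + 0) + (label (i + b) + (label (i + suc b) + (label (i + (2 + b)) +
      (label (i + (b + (2 + b))) + (label (i + (suc b + m)) + 0)))))) ℤ.- + r)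
      ≡⟨ cong (λ e → + 6 ℤ.* (+ e ℤ.- + r)) labels-sum ⟩
    + 6 ℤ.* (+ r ℤ.- + r)
      ≡⟨ cong (ℤ._*_ (+ 6)) (ℤₚ.+-inverseʳ (+ r)) ⟩
    0ℤ ∎
    where
    open ≡-Reasoning
    labels-sum = trans (sym (sum-↭ (↭.map⁺ (λ x → suc (toℕ (Bijection.to ℓ x))) (closedNeighbourhood-↭ i))))
                       (magic [ + (i + suc b) ])
    eq : ∀ a₁ a₂ a₃ a₄ a₅ a₆ r →
      (+ 6 ℤ.* a₁ ℤ.- r) ℤ.+ (+ 6 ℤ.* a₂ ℤ.- r) ℤ.+ (+ 6 ℤ.* a₄ ℤ.- r) ℤ.+ (+ 6 ℤ.* a₅ ℤ.- r)
        ℤ.+ (+ 6 ℤ.* a₃ ℤ.- r) ℤ.+ (+ 6 ℤ.* a₆ ℤ.- r) ≡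
      + 6 ℤ.* ((a₁ ℤ.+ (a₂ ℤ.+ (a₃ ℤ.+ (a₄ ℤ.+ (a₅ ℤ.+ (a₆ ℤ.+ 0ℤ)))))) ℤ.- r)
    eq = ℤSolver.solve-∀
  v-injective : ∀ d → v d ≡ v 0 → m * 2 ∣ d
  v-injective d h = subst (m * 2 ∣_) (ℕₚ.+-identityʳ d) (ℤ∣.∣⇒∣ᵤ ([]-injective (+ d) (+ 0)
    (Bijection.injective ℓ (toℕ-injective (ℕₚ.suc-injective (ℤₚ.+-injective
      (ℤₚ.*-cancelˡ-≡ (+ 6) (+ label d) (+ label 0)
        (+-cancelʳ (ℤ.- + r) (+ 6 ℤ.* + label d) (+ 6 ℤ.* + label 0) h))))))))

odd*2%4≡2 : ∀ {m} → (Σ ℕ λ k → m ≡ suc (k * 2)) → m * 2 % 4 ≡ 2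
odd*2%4≡2 (k , refl) = trans (cong (_% 4) (eq k)) ([m+kn]%n≡m%n 2 k 4)
  where
  eq : ∀ k → suc (k * 2) * 2 ≡ 2 + k * 4
  eq = ℕSolver.solve-∀

odd-multiple : ∀ l {m} (let b = suc (l * 2)) → m ∣ b * (2 + b) →
  Σ ℕ λ q → ¬ (2 ∣ q) × 2 * (suc b ^ 2 ∸ 1) ≡ q * (m * 2)
odd-multiple l {m} (divides q eq) =
  q , odd , trans (cong (λ e → 2 * (e ∸ 1)) (square b)) (trans (cong (2 *_) eq) (twice q m))
  where
  b = suc (l * 2)
  square : ∀ b → suc b * (suc b * 1) ≡ suc (b * (2 + b))
  square = ℕSolver.solve-∀
  twice : ∀ q m → 2 * (q * m) ≡ q * (m * 2)
  twice = ℕSolver.solve-∀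
  odd : ¬ (2 ∣ q)
  odd (divides p refl) = ℕₚ.even≢odd (p * m) (l * 2 * l + 4 * l + 1) (trans (left p m) (trans (sym eq) (right l)))
    where
    left : ∀ p m → 2 * (p * m) ≡ p * 2 * m
    left = ℕSolver.solve-∀
    right : ∀ l → suc (l * 2) * (2 + suc (l * 2)) ≡ suc (2 * (l * 2 * l + 4 * l + 1))
    right = ℕSolver.solve-∀

proposition4p8 : ∀ (n c : ℕ) .{{_ : NonZero n}} →
    6 ≤ n → 2 ∣ n → 1 < c → c < n / 2 →
    ClosedDistanceMagic (Cay n (connectionSet n c)) →
    Σ (Fin n) (IsType2 n c) →
    2 ∣ c →
    Σ ℕ λ c′ →
    1 < c′ × c′ < n / 2 ×
    Cay n (connectionSet n c) ≅ Cay n (connectionSet n c′) ×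
    n % 4 ≡ 2 ×
    2 ∣ c′ ×
    (Σ ℕ λ k → ¬ (2 ∣ k) × 2 * (c′ ^ 2 ∸ 1) ≡ k * n)
proposition4p8 .(m * 2) .(suc l * 2) _ (divides m refl) 1<c c<n/2 magic _ 2∣c@(divides (suc l) refl) =
  suc l * 2 , 1<c , c<n/2 , (⤖-id _ , λ _ _ → ⇔-id _) , odd*2%4≡2 (proj₁ result) , 2∣c ,
  odd-multiple l (proj₂ result)
  where
  result = closedDistanceMagic⇒∣ l m (subst (suc l * 2 <_) (m*n/n≡m m 2) c<n/2) magic
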